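{- Let $n$ and $k$ be positive integers with $k \ge 2$. For every integer $m \ge n+k+2$ and every graph $G$ with $\chi_P(G)=k$ and $|V(G)|=n$: if there is a special enumeration of $V(G)$, then $\chi_P(R_m(G))=k$; otherwise, $\chi_P(R_m(G))=k+1$.
   Context: Graphs are finite and simple; $[m]=\{1,\dots,m\}$. For a set $X$ of vertices of $G$, $\chi(X)$ denotes the chromatic number of the subgraph of $G$ induced by $X$. A path-decomposition of a graph $G$ is a sequence $B_1,\dots,B_s$ of subsets of $V(G)$ (bags) such that $V(G)=\bigcup_t B_t$; for each $uv\in E(G)$ there is $t$ with $u,v\in B_t$; and for each $v\in V(G)$ the sets $B_t$ containing $v$ are consecutive in the sequence. The chromatic number of a path-decomposition is $\max_t \chi(B_t)$. The path-chromatic number $\chi_P(G)$ is the minimum chromatic number over all path-decompositions of $G$. The closed neighborhood $N[U]$ of a set $U$ of vertices is $U$ together with all vertices having a neighbor in $U$. For an enumeration $\sigma=v_1,\dots,v_n$ of $V(G)$ (each vertex listed exactly once), $P_\sigma^G$ is the sequence $X_1,\dots,X_n$ with $X_\ell=N[\{v_1,\dots,v_\ell\}]\setminus\{v_1,\dots,v_{\ell-1}\}$; it is a path-decomposition of $G$, and $\chi(P_\sigma^G)=\max_\ell\chi(X_\ell)$ is its chromatic number. The enumeration $\sigma$ is special if (i) $\chi(P_\sigma^G)=\chi_P(G)$ and (ii) for every $1\le i\le n$ with $\chi(X_i)=\chi_P(G)$, the vertex $v_i$ has no neighbor in $\{v_1,\dots,v_{i-1}\}$. For a graph $G$ and a positive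 integer $m$, $R_m(G)$ is the graph with vertex set $\{(i,v): i\in[m],\ v\in V(G)\cup\{v_0\}\}$, where $v_0\notin V(G)$ is a new element, in which two distinct vertices $(i,v)$ and $(i',v')$ are adjacent if and only if either $i=i'$ and exactly one of $v,v'$ equals $v_0$, or $i\ne i'$, $v,v'\in V(G)$ and $vv'\in E(G)$. -}

module Defs where

open import Data.Bool using (Bool; true; false; T)
open import Data.Bool.Properties using (T?; T-irrelevant)
open import Data.Fin as Fin using (Fin; zero; suc; finToFun; funToFin)
import Data.Fin.Properties as Fin
open import Data.Maybe using (Maybe; just; nothing)
open import Data.Nat using (ℕ; zero; suc; _*_; _^_; _⊔_; _≤_; z≤n; s≤s)
open import Data.Nat.Properties using (≤-trans)
open import Data.Product using (Σ; ∃; _×_; _,_; proj₁; proj₂)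
open import Data.Product.Function.NonDependent.Propositional using (_×-↔_)
open import Data.Sum using (_⊎_; inj₁; inj₂)
import Data.Vec.Functional as Vector
open import Function using (_∘_; _↔_; mk↔ₛ′; Inverse)
open import Function.Construct.Composition using (_↔-∘_)
open import Function.Construct.Identity using (↔-id)
open import Level using (Level; 0ℓ)
open import Relation.Binary using (Rel; Symmetric; Decidable)
open import Relation.Binary.PropositionalEquality
  using (_≡_; _≢_; refl; sym; trans; cong; subst)
open import Relation.Nullary using (¬_; Dec; yes; no; contradiction)
open import Relation.Nullary.Decidable
  using (map′; ¬?; _×-dec_; _⊎-dec_; _→-dec_; ⌊_⌋; toWitness; fromWitness)
import Relation.Unary as U

private variable
  ℓ : Level

IsLeast : (ℕ → Set ℓ) → ℕ → Set ℓ
IsLeast P k = P k × (∀ d → P d → k ≤ d)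

least : {P : ℕ → Set ℓ} → U.Decidable P → ∀ n → P n → ∃ (IsLeast P)
least P? zero p = zero , p , λ _ _ → z≤n
least {P = P} P? (suc n) p with P? zero
... | yes p₀ = zero , p₀ , λ _ _ → z≤n
... | no ¬p₀ with least {P = P ∘ suc} (P? ∘ suc) n p
...   | k , pk , lb = suc k , pk , λ where
          zero q → contradiction q ¬p₀
          (suc d) q → s≤s (lb d q)

-- Decidability of adjacency holds classically for every graph; it is
-- required so that chromatic numbers can be computed.
record Graph : Set₁ where
  field
    Vertex    : Set
    order     : ℕ
    enum      : Fin order ↔ Vertex
    Adj       : Rel Vertex 0ℓ
    adj?      : Decidable Adj
    adj-sym   : Symmetric Adj
    adj-irrefl : ∀ {v} → ¬ Adj v v

open Graph public using (Vertex; order)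

module _ (G : Graph) where
  open Graph G using (enum)

  allVertices? : {P : Vertex G → Set} → U.Decidable P → Dec (∀ v → P v)
  allVertices? {P} P? =
    map′ (λ h v → subst P (Inverse.strictlyInverseˡ enum v) (h _))
         (λ h i → h _)
         (Fin.all? (P? ∘ Inverse.to enum))

  anyVertex? : {P : Vertex G → Set} → U.Decidable P → Dec (∃ P)
  anyVertex? {P} P? =
    map′ (λ (i , p) → _ , p)
         (λ (v , p) → Inverse.from enum v ,
                      subst P (sym (Inverse.strictlyInverseˡ enum v)) p)
         (Fin.any? (P? ∘ Inverse.to enum))

module _ (G : Graph) where
  open Graph G using (enum; Adj; adj?; adj-irrefl)

  Proper : ∀ {c} → (Vertex G → Fin c) → Set
  Proper f = ∀ u v → Adj u v → f u ≢ f v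

  Colourable : ℕ → Set
  Colourable c = ∃ λ (f : Vertex G → Fin c) → Proper f

  colourable? : U.Decidable Colourable
  colourable? c = map′
    (λ (j , p) → colouring j , p)
    (λ (f , p) → funToFin (f ∘ Inverse.to enum) , λ u v a e →
       p u v a (trans (sym (code f u)) (trans e (code f v))))
    (Fin.any? λ j → allVertices? G λ u → allVertices? G λ v →
       adj? u v →-dec ¬? (colouring j u Fin.≟ colouring j v))
    where
    colouring : Fin (c ^ order G) → Vertex G → Fin c
    colouring j = finToFun j ∘ Inverse.from enum
    code : ∀ f v → colouring (funToFin (f ∘ Inverse.to enum)) v ≡ f v
    code f v = trans (Fin.finToFun-funToFin (f ∘ Inverse.to enum) _)
                     (cong f (Inverse.strictlyInverseˡ enum v))

  orderColourable : Colourable (order G)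
  orderColourable = Inverse.from enum , λ u v a e →
    adj-irrefl (subst (Adj u) (sym
      (trans (sym (Inverse.strictlyInverseˡ enum u))
        (trans (cong (Inverse.to enum) e) (Inverse.strictlyInverseˡ enum v)))) a)

  private
    leastColours : ∃ (IsLeast Colourable)
    leastColours = least colourable? (order G) orderColourable

  chromaticNumber : ℕ
  chromaticNumber = proj₁ leastColours

  chromaticNumber-isLeast : IsLeast Colourable chromaticNumber
  chromaticNumber-isLeast = proj₂ leastColours

VertexSet : Graph → Set
VertexSet G = Vertex G → Bool

infix 4 _∈_
_∈_ : {V : Set} → V → (V → Bool) → Set
v ∈ X = T (X v)

private
  Σ-≡ : {A : Set} {X : A → Bool} {x y : A} {p : x ∈ X} {q : y ∈ X} →
        x ≡ y → _≡_ {A = Σ A (_∈ X)} (x , p) (y , q)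
  Σ-≡ refl = cong (_ ,_) (T-irrelevant _ _)

  enumSubset : ∀ n (X : Fin n → Bool) → ∃ λ c → Fin c ↔ Σ (Fin n) (_∈ X)
  enumSubset zero X = 0 , mk↔ₛ′ (λ ()) (λ ()) (λ ()) (λ ())
  enumSubset (suc n) X with enumSubset n (X ∘ suc) | X zero in eq
  ... | c , e | false = c , mk↔ₛ′ to from to∘from (Inverse.strictlyInverseʳ e)
    where
    to : Fin c → Σ (Fin (suc n)) (_∈ X)
    to i = suc (proj₁ (Inverse.to e i)) , proj₂ (Inverse.to e i)
    from : Σ (Fin (suc n)) (_∈ X) → Fin c
    from (zero , p) = contradiction (subst T eq p) (λ ())
    from (suc j , p) = Inverse.from e (j , p)
    to∘from : ∀ y → to (from y) ≡ y
    to∘from (zero , p) = contradiction (subst T eq p) (λ ())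
    to∘from (suc j , p) = Σ-≡ (cong (suc ∘ proj₁) (Inverse.strictlyInverseˡ e (j , p)))
  ... | c , e | true = suc c , mk↔ₛ′ to from to∘from from∘to
    where
    to : Fin (suc c) → Σ (Fin (suc n)) (_∈ X)
    to zero = zero , subst T (sym eq) _
    to (suc i) = suc (proj₁ (Inverse.to e i)) , proj₂ (Inverse.to e i)
    from : Σ (Fin (suc n)) (_∈ X) → Fin (suc c)
    from (zero , p) = zero
    from (suc j , p) = suc (Inverse.from e (j , p))
    to∘from : ∀ y → to (from y) ≡ y
    to∘from (zero , p) = Σ-≡ refl
    to∘from (suc j , p) = Σ-≡ (cong (suc ∘ proj₁) (Inverse.strictlyInverseˡ e (j , p)))
    from∘to : ∀ i → from (to i) ≡ i
    from∘to zero = refl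
    from∘to (suc i) = cong suc (Inverse.strictlyInverseʳ e i)

induced : (G : Graph) → VertexSet G → Graph
induced G X = record
  { Vertex     = Σ (Vertex G) (_∈ X)
  ; order      = proj₁ sub
  ; enum       = restrict ↔-∘ proj₂ sub
  ; Adj        = λ u v → Adj (proj₁ u) (proj₁ v)
  ; adj?       = λ u v → adj? (proj₁ u) (proj₁ v)
  ; adj-sym    = adj-sym
  ; adj-irrefl = adj-irrefl
  }
  where
  open Graph G using (enum; Adj; adj?; adj-sym; adj-irrefl)
  sub = enumSubset (order G) (X ∘ Inverse.to enum)
  restrict : Σ (Fin (order G)) (_∈ (X ∘ Inverse.to enum)) ↔ Σ (Vertex G) (_∈ X)
  restrict = mk↔ₛ′
    (λ (i , p) → Inverse.to enum i , p)
    (λ (v , p) → Inverse.from enum v ,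
                 subst (_∈ X) (sym (Inverse.strictlyInverseˡ enum v)) p)
    (λ (v , _) → Σ-≡ (Inverse.strictlyInverseˡ enum v))
    (λ (i , _) → Σ-≡ (Inverse.strictlyInverseʳ enum i))

χ : (G : Graph) → VertexSet G → ℕ
χ G X = chromaticNumber (induced G X)

record PathDecomposition (G : Graph) : Set where
  open Graph G using (Adj)
  field
    length      : ℕ
    bag         : Fin length → VertexSet G
    covers      : ∀ v → ∃ λ t → v ∈ bag t
    coversEdges : ∀ u v → Adj u v → ∃ λ t → u ∈ bag t × v ∈ bag t
    consecutive : ∀ v {r s t} → r Fin.≤ s → s Fin.≤ t →
                  v ∈ bag r → v ∈ bag t → v ∈ bag s

χ-decomposition : {G : Graph} → PathDecomposition G → ℕ
χ-decomposition {G} P = Vector.foldr _⊔_ 0 (χ G ∘ bag)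
  where open PathDecomposition P

-- "χ_P(G) = k".
IsPathChromaticNumber : Graph → ℕ → Set
IsPathChromaticNumber G =
  IsLeast (λ c → ∃ λ (P : PathDecomposition G) → χ-decomposition P ≡ c)

module _ (G : Graph) where
  open Graph G using (Adj; adj?; adj-sym; adj-irrefl)

  InClosedNeighbourhood : VertexSet G → Vertex G → Set
  InClosedNeighbourhood U v = v ∈ U ⊎ ∃ λ u → u ∈ U × Adj v u

  inClosedNeighbourhood? : ∀ U → U.Decidable (InClosedNeighbourhood U)
  inClosedNeighbourhood? U v =
    T? (U v) ⊎-dec anyVertex? G λ u → T? (U u) ×-dec adj? v u

  N[_] : VertexSet G → VertexSet G
  N[ U ] v = ⌊ inClosedNeighbourhood? U v ⌋

  _∖_ : VertexSet G → VertexSet G → VertexSet G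
  (A ∖ B) v = ⌊ T? (A v) ×-dec ¬? (T? (B v)) ⌋

  Enumeration : Set
  Enumeration = Fin (order G) ↔ Vertex G

  module _ (σ : Enumeration) where
    private
      index : Vertex G → Fin (order G)
      index = Inverse.from σ

    -- With i the (0-based) position ℓ - 1, these are {v₁,…,v_ℓ} and
    -- {v₁,…,v_{ℓ-1}}: membership is decided by the position of v in σ.
    upTo before : Fin (order G) → VertexSet G
    upTo   i v = ⌊ index v Fin.≤? i ⌋
    before i v = ⌊ index v Fin.<? i ⌋

    X[_] : Fin (order G) → VertexSet G
    X[ i ] = N[ upTo i ] ∖ before i

    private
      ∈X : ∀ {i v} → InClosedNeighbourhood (upTo i) v → ¬ (index v Fin.< i) → v ∈ X[ i ]
      ∈X a b = fromWitness (fromWitness a , b ∘ toWitness)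

      ∈X⁻ : ∀ {i v} → v ∈ X[ i ] → InClosedNeighbourhood (upTo i) v × ¬ (index v Fin.< i)
      ∈X⁻ p with a , b ← toWitness p = toWitness a , b ∘ fromWitness

      upTo-mono : ∀ {i j v} → i Fin.≤ j → v ∈ upTo i → v ∈ upTo j
      upTo-mono i≤j p = fromWitness (≤-trans (toWitness p) i≤j)

      N-mono : ∀ {i j v} → i Fin.≤ j →
               InClosedNeighbourhood (upTo i) v → InClosedNeighbourhood (upTo j) v
      N-mono {v = v} i≤j (inj₁ p) = inj₁ (upTo-mono {v = v} i≤j p)
      N-mono i≤j (inj₂ (u , p , a)) = inj₂ (u , upTo-mono {v = u} i≤j p , a)

      own : ∀ v → v ∈ X[ index v ]
      own v = ∈X (inj₁ (fromWitness (Fin.≤-refl {x = index v}))) (Fin.<-irrefl refl)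

      later : ∀ {u v} → Adj u v → index u Fin.≤ index v → v ∈ X[ index u ]
      later {u} a i≤j =
        ∈X (inj₂ (u , fromWitness (Fin.≤-refl {x = index u}) , adj-sym a))
           (λ lt → Fin.<-irrefl refl (≤-trans lt i≤j))

    P[_] : PathDecomposition G
    P[_] = record
      { length = order G
      ; bag = X[_]
      ; covers = λ v → index v , own v
      ; coversEdges = edges
      ; consecutive = λ v r≤s s≤t p q →
          ∈X (N-mono r≤s (proj₁ (∈X⁻ {v = v} p)))
             (λ lt → proj₂ (∈X⁻ {v = v} q) (≤-trans lt s≤t))
      }
      where
      edges : ∀ u v → Adj u v → ∃ λ t → u ∈ X[ t ] × v ∈ X[ t ]
      edges u v a with Fin.≤-total (index u) (index v)
      ... | inj₁ le = index u , own u , later a le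
      ... | inj₂ le = index v , later (adj-sym a) le , own v

    IsSpecial : Set
    IsSpecial =
      IsPathChromaticNumber G (χ-decomposition P[_]) ×
      (∀ i → IsPathChromaticNumber G (χ G X[ i ]) →
         ∀ j → j Fin.< i → ¬ Adj (Inverse.to σ i) (Inverse.to σ j))

module _ (m : ℕ) (G : Graph) where
  open Graph G using (enum; Adj; adj?; adj-sym; adj-irrefl)

  -- The new element v₀ is nothing.
  data RAdj : Rel (Fin m × Maybe (Vertex G)) 0ℓ where
    fromHub : ∀ {i v} → RAdj (i , nothing) (i , just v)
    toHub   : ∀ {i v} → RAdj (i , just v) (i , nothing)
    across  : ∀ {i i′ v v′} → i ≢ i′ → Adj v v′ → RAdj (i , just v) (i′ , just v′)

  private
    RAdj? : Decidable RAdj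
    RAdj? (i , nothing) (j , nothing) = no λ ()
    RAdj? (i , nothing) (j , just v) =
      map′ (λ { refl → fromHub }) (λ { fromHub → refl }) (i Fin.≟ j)
    RAdj? (i , just u) (j , nothing) =
      map′ (λ { refl → toHub }) (λ { toHub → refl }) (i Fin.≟ j)
    RAdj? (i , just u) (j , just v) =
      map′ (λ (p , q) → across p q) (λ { (across p q) → p , q })
           (¬? (i Fin.≟ j) ×-dec adj? u v)

    RAdj-sym : Symmetric RAdj
    RAdj-sym fromHub = toHub
    RAdj-sym toHub = fromHub
    RAdj-sym (across p a) = across (p ∘ sym) (adj-sym a)

    RAdj-irrefl : ∀ {x} → ¬ RAdj x x
    RAdj-irrefl (across p _) = p refl

    withHub : Fin (suc (order G)) ↔ Maybe (Vertex G)
    withHub = mk↔ₛ′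
      (λ { zero → nothing ; (suc i) → just (Inverse.to enum i) })
      (λ { nothing → zero ; (just v) → suc (Inverse.from enum v) })
      (λ { nothing → refl ; (just v) → cong just (Inverse.strictlyInverseˡ enum v) })
      (λ { zero → refl ; (suc i) → cong suc (Inverse.strictlyInverseʳ enum i) })

  R : Graph
  R = record
    { Vertex     = Fin m × Maybe (Vertex G)
    ; order      = m * suc (order G)
    ; enum       = (↔-id (Fin m) ×-↔ withHub) ↔-∘ Fin.*↔×
    ; Adj        = RAdj
    ; adj?       = RAdj?
    ; adj-sym    = RAdj-sym
    ; adj-irrefl = RAdj-irrefl
    }

{-# OPTIONS --safe #-}
-- Copies of V(G) are independent in R m G, and any choice of distinct copies of
-- the vertices of G spans G; this gives χ_P(R m G) ≥ χ_P(G), while adding all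
-- hubs to a blown-up decomposition costs one colour.
--
-- A special enumeration saves that colour: process the copies of v_ℓ one at a
-- time, in bags consisting of the hubs, one copy of v_ℓ, and all copies of the
-- later vertices with a neighbour among v_1, …, v_ℓ. These later vertices span
-- chromatic number at most k − 1.
--
-- Conversely, given a decomposition of R m G into k-colourable bags, enumerate
-- V(G) by the time at which the first copy of each vertex disappears. When v_ℓ
-- disappears, all vertices of X_ℓ with a neighbour among v_1, …, v_ℓ are present
-- in all but at most ℓ copies. A vertex present in more than k copies has a
-- repeated colour, and repeated colours give a proper colouring of G; a hub
-- meeting such copies excludes one more colour. If v_ℓ has an earlier neighbour
-- and χ(X_ℓ) = k, then ℓ ≤ n + 1 − k, so at least 2k + 1 copies contain X_ℓ, and
-- the hubs of k + 1 of them lie on the same side of the current bag; the one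
-- closest to it meets all k + 1 copies of X_ℓ, so that χ(X_ℓ) ≤ k − 1.
module Submission where

open import Defs
open import Data.Bool using (true)
open import Data.Bool.Properties using (T?)
open import Data.Empty using (⊥)
open import Data.Fin as Fin
  using (Fin; zero; suc; toℕ; fromℕ; fromℕ<; inject₁; inject≤; punchIn; punchOut; combine; remQuot)
import Data.Fin.Properties as Fin
open import Data.Fin.Permutation using (Permutation′; _⟨$⟩ʳ_; insert; insert-punchIn; id)
open import Data.List using (List; []; _∷_; length; lookup; filter; allFin; tabulate)
open import Data.List.Properties using (filter-all; length-tabulate)
open import Data.List.Membership.Propositional using (find; lose) renaming (_∈_ to _∈ₗ_)
open import Data.List.Membership.Propositional.Properties
  using (∈-lookup; ∈-filter⁻; ∈-tabulate⁺)
open import Data.List.Relation.Unary.All as All using ([]; _∷_)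
open import Data.List.Relation.Unary.AllPairs using ([]; _∷_)
open import Data.List.Relation.Unary.Any using (Any; here; there; any?)
open import Data.List.Relation.Unary.Unique.Propositional using (Unique)
open import Data.List.Relation.Unary.Unique.Propositional.Properties using (allFin⁺; filter⁺)
open import Data.Maybe using (just; nothing)
open import Data.Nat using (ℕ; zero; suc; _+_; _*_; _∸_; _⊔_; _≤_; _<_; z≤n; s≤s)
import Data.Nat.Properties as ℕ
open import Data.Nat.Tactic.RingSolver using (solve-∀)
open import Data.Product using (∃; ∃₂; _×_; _,_; proj₁; proj₂; map₂)
open import Data.Sum using (_⊎_; inj₁; inj₂; [_,_]′)
import Data.Vec.Functional as Vector
open import Function using (_∘_; Inverse)
open import Function.Construct.Composition using (_↔-∘_)
open import Relation.Binary.PropositionalEquality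
  using (_≡_; _≢_; refl; sym; trans; cong; cong₂; subst; subst₂)
open import Relation.Nullary using (¬_; Dec; yes; no; contradiction; ¬?)
open import Relation.Nullary.Decidable
  using (_×-dec_; _⊎-dec_; ⌊_⌋; toWitness; fromWitness)
import Relation.Unary as U

open PathDecomposition using (bag; covers; coversEdges; consecutive)

-- Extremal elements of finite sets

leastFin : ∀ {n} {P : Fin n → Set} → U.Decidable P → ∃ P →
           ∃ λ i → P i × (∀ j → P j → i Fin.≤ j)
leastFin {suc n} P? (i , p) with P? zero
... | yes p₀ = zero , p₀ , λ _ _ → z≤n
leastFin P? (zero  , p) | no ¬p₀ = contradiction p ¬p₀
leastFin P? (suc i , p) | no ¬p₀ with j , pj , lb ← leastFin (P? ∘ suc) (i , p) =
  suc j , pj , λ where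
    zero    q → contradiction q ¬p₀
    (suc l) q → s≤s (lb l q)

greatestFin : ∀ {n} {P : Fin n → Set} → U.Decidable P → ∃ P →
              ∃ λ i → P i × (∀ j → P j → j Fin.≤ i)
greatestFin {suc n} P? (i , p) with Fin.any? (P? ∘ suc)
... | yes q with j , pj , ub ← greatestFin (P? ∘ suc) q =
  suc j , pj , λ where
    zero    _ → z≤n
    (suc l) r → s≤s (ub l r)
greatestFin P? (zero  , p) | no ¬q = zero , p , λ where
  zero    _ → z≤n
  (suc l) r → contradiction (l , r) ¬q
greatestFin P? (suc i , p) | no ¬q = contradiction (i , p) ¬q

argmin : ∀ {n} (e : Fin (suc n) → ℕ) → ∃ λ i → ∀ j → e i ≤ e j
argmin {zero}  e = zero , λ { zero → ℕ.≤-refl }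
argmin {suc n} e with i , lb ← argmin (e ∘ suc) | ℕ.≤-total (e zero) (e (suc i))
... | inj₁ le = zero , λ { zero → ℕ.≤-refl ; (suc j) → ℕ.≤-trans le (lb j) }
... | inj₂ ge = suc i , λ { zero → ge ; (suc j) → lb j }

-- Selection sort: an index with minimal value is put first, and the remaining indices are sorted
-- recursively.
sortingPermutation : ∀ {n} (e : Fin n → ℕ) → ∃ λ (π : Permutation′ n) →
                     ∀ i j → i Fin.≤ j → e (π ⟨$⟩ʳ i) ≤ e (π ⟨$⟩ʳ j)
sortingPermutation {zero}  e = id , λ ()
sortingPermutation {suc n} e
  with i₀ , lb ← argmin e
  with π , mono ← sortingPermutation (e ∘ punchIn i₀) =
  insert zero i₀ π , λ where
    zero    j       _         → lb _
    (suc i) (suc j) (s≤s i≤j) →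
      subst₂ _≤_ (at i) (at j) (mono i j i≤j)
  where
  at : ∀ i → e (punchIn i₀ (π ⟨$⟩ʳ i)) ≡ e (insert zero i₀ π ⟨$⟩ʳ suc i)
  at i = cong e (sym (insert-punchIn zero i₀ π i))

-- Duplicate-free lists

module _ {A : Set} where

  lookup-distinct : ∀ {xs : List A} → Unique xs → ∀ {i j} → i Fin.< j →
                    lookup xs i ≢ lookup xs j
  lookup-distinct {_ ∷ xs} (x∉ ∷ _) {zero}  {suc j} _ = All.lookup x∉ (∈-lookup {xs = xs} j)
  lookup-distinct {_ ∷ _}  (_ ∷ u)  {suc i} {suc j} (s≤s i<j) = lookup-distinct u i<j

  length-filter-split : ∀ {P : A → Set} (P? : U.Decidable P) xs →
    length xs ≡ length (filter P? xs) + length (filter (¬? ∘ P?) xs)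
  length-filter-split P? [] = refl
  length-filter-split P? (x ∷ xs) with P? x
  ... | yes _ = cong suc (length-filter-split P? xs)
  ... | no  _ = trans (cong suc (length-filter-split P? xs)) (sym (ℕ.+-suc _ _))

module _ {m : ℕ} where

  pigeonholeList : ∀ {c} {xs : List (Fin m)} → Unique xs → c < length xs → (f : Fin m → Fin c) →
                   ∃₂ λ p q → p ∈ₗ xs × q ∈ₗ xs × p ≢ q × f p ≡ f q
  pigeonholeList {xs = xs} u lt f with i , j , i<j , eq ← Fin.pigeonhole lt (f ∘ lookup xs) =
    _ , _ , ∈-lookup {xs = xs} i , ∈-lookup {xs = xs} j , lookup-distinct u i<j , eq

  length-remove : ∀ y {xs : List (Fin m)} → Unique xs →
                  length xs ≤ suc (length (filter (¬? ∘ (y Fin.≟_)) xs))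
  length-remove y [] = z≤n
  length-remove y {x ∷ xs} (x∉ ∷ u) with y Fin.≟ x
  ... | yes refl = s≤s (ℕ.≤-reflexive (cong length (sym (filter-all (¬? ∘ (y Fin.≟_)) x∉))))
  ... | no  _    = s≤s (length-remove y u)

  -- Each entry of `ys` removes at most one index from the full list. Since `ys` may repeat entries,
  -- the lengths satisfy only an inequality.
  complement : (ys : List (Fin m)) → ∃ λ xs →
    Unique xs × m ≤ length ys + length xs × (∀ {x} → x ∈ₗ xs → ¬ x ∈ₗ ys)
  complement [] = allFin m , allFin⁺ m , ℕ.≤-reflexive (sym (length-tabulate {n = m} _)) , λ _ ()
  complement (y ∷ ys) with xs , u , le , disjoint ← complement ys =
    filter ≢y? xs , filter⁺ ≢y? u ,
    ℕ.≤-trans le (ℕ.≤-trans (ℕ.+-monoʳ-≤ (length ys) (length-remove y u))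
                            (ℕ.≤-reflexive (ℕ.+-suc _ _))) ,
    λ p → λ where
      (here refl) → proj₂ (∈-filter⁻ ≢y? {xs = xs} p) refl
      (there q)   → disjoint (proj₁ (∈-filter⁻ ≢y? {xs = xs} p)) q
    where
    ≢y? = ¬? ∘ (y Fin.≟_)

-- Chromatic numbers of vertex sets

module _ (G : Graph) where
  open Graph G using (Adj)

  ProperOn : ∀ {c} → VertexSet G → (Vertex G → Fin c) → Set
  ProperOn X f = ∀ {u v} → u ∈ X → v ∈ X → Adj u v → f u ≢ f v

  extendColouring : ∀ {c d} X → Colourable (induced G X) d → d ≤ suc c →
                    ∃ λ (f : Vertex G → Fin (suc c)) → ProperOn X f
  extendColouring {c} X (g , proper) le = f , f-proper
    where
    f : Vertex G → Fin (suc c)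
    f v with T? (X v)
    ... | yes p = inject≤ (g (v , p)) le
    -- A dummy value outside `X`; it exists because the palette `Fin (suc c)` is nonempty.
    ... | no  _ = zero
    f-proper : ProperOn X f
    f-proper {u} {v} p q a with T? (X u) | T? (X v)
    ... | yes p′ | yes q′ = proper (u , p′) (v , q′) a ∘ Fin.inject≤-injective le le _ _
    ... | yes _  | no ¬q  = contradiction q ¬q
    ... | no ¬p  | _      = contradiction p ¬p

  χ-colouring : ∀ X → Colourable (induced G X) (χ G X)
  χ-colouring X = proj₁ (chromaticNumber-isLeast (induced G X))

  χ≤⇒colouring : ∀ {c} X → χ G X ≤ suc c → ∃ λ (f : Vertex G → Fin (suc c)) → ProperOn X f
  χ≤⇒colouring X = extendColouring X (χ-colouring X)

  colouring⇒χ≤ : ∀ {c} X (f : ∀ v → v ∈ X → Fin c) →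
                 (∀ {u v} p q → Adj u v → f u p ≢ f v q) → χ G X ≤ c
  colouring⇒χ≤ X f proper =
    proj₂ (chromaticNumber-isLeast (induced G X)) _
      ((λ (v , p) → f v p) , λ (u , p) (v , q) → proper p q)

  properOn⇒χ≤ : ∀ {c} X (f : Vertex G → Fin c) → ProperOn X f → χ G X ≤ c
  properOn⇒χ≤ X f proper = colouring⇒χ≤ X (λ v _ → f v) proper

module _ {G H : Graph} (h : Vertex G → Vertex H)
         (hom : ∀ {u v} → Graph.Adj G u v → Graph.Adj H (h u) (h v)) where

  χ-hom : ∀ X Y → (∀ v → v ∈ X → h v ∈ Y) → χ G X ≤ χ H Y
  χ-hom X Y sub = pull (χ-colouring H Y)
    where
    pull : ∀ {d} → Colourable (induced H Y) d → χ G X ≤ d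
    pull (g , proper) =
      colouring⇒χ≤ G X (λ v p → g (h v , sub v p)) (λ p q a → proper _ _ (hom a))

χ-mono : ∀ (G : Graph) X Y → (∀ v → v ∈ X → v ∈ Y) → χ G X ≤ χ G Y
χ-mono G = χ-hom {G} {G} (λ v → v) (λ a → a)

-- Chromatic numbers of path-decompositions

≤foldr-⊔ : ∀ {s} (f : Fin s → ℕ) t → f t ≤ Vector.foldr _⊔_ 0 f
≤foldr-⊔ f zero    = ℕ.m≤m⊔n _ _
≤foldr-⊔ f (suc t) = ℕ.≤-trans (≤foldr-⊔ (f ∘ suc) t) (ℕ.m≤n⊔m (f zero) _)

foldr-⊔≤ : ∀ {s c} (f : Fin s → ℕ) → (∀ t → f t ≤ c) → Vector.foldr _⊔_ 0 f ≤ c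
foldr-⊔≤ {zero}  f le = z≤n
foldr-⊔≤ {suc s} f le = ℕ.⊔-lub (le zero) (foldr-⊔≤ (f ∘ suc) (le ∘ suc))

module _ {G : Graph} (D : PathDecomposition G) where
  χ-bag≤ : ∀ t → χ G (bag D t) ≤ χ-decomposition D
  χ-bag≤ = ≤foldr-⊔ (χ G ∘ bag D)

  χ-decomposition≤ : ∀ {c} → (∀ t → χ G (bag D t) ≤ c) → χ-decomposition D ≤ c
  χ-decomposition≤ = foldr-⊔≤ (χ G ∘ bag D)

  bagColouring : ∀ {c} → χ-decomposition D ≤ suc c → ∀ t →
                 ∃ λ (f : Vertex G → Fin (suc c)) → ProperOn G (bag D t) f
  bagColouring le t = χ≤⇒colouring G (bag D t) (ℕ.≤-trans (χ-bag≤ t) le)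

  isPathChromaticNumber : ∀ {k} → χ-decomposition D ≤ k →
    (∀ (E : PathDecomposition G) → k ≤ χ-decomposition E) → IsPathChromaticNumber G k
  isPathChromaticNumber le lb =
    (D , ℕ.≤-antisym le (lb D)) , λ { _ (E , refl) → lb E }

pathChromaticNumber≤ : ∀ {G k} → IsPathChromaticNumber G k →
                       ∀ (D : PathDecomposition G) → k ≤ χ-decomposition D
pathChromaticNumber≤ (_ , lb) D = lb _ (D , refl)

pathChromaticNumber-unique : ∀ G a b →
  IsPathChromaticNumber G a → IsPathChromaticNumber G b → a ≡ b
pathChromaticNumber-unique G a b (pa , la) (pb , lb) = ℕ.≤-antisym (la b pb) (lb a pa)

module _ {G H : Graph} (h : Vertex G → Vertex H)
         (hom : ∀ {u v} → Graph.Adj G u v → Graph.Adj H (h u) (h v))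
         (D : PathDecomposition H) where

  pullback : PathDecomposition G
  pullback = record
    { length      = PathDecomposition.length D
    ; bag         = λ t → bag D t ∘ h
    ; covers      = covers D ∘ h
    ; coversEdges = λ u v a → coversEdges D (h u) (h v) (hom a)
    ; consecutive = λ v {r} {s} {t} → consecutive D (h v) {r} {s} {t}
    }

  χ-pullback≤ : χ-decomposition pullback ≤ χ-decomposition D
  χ-pullback≤ = χ-decomposition≤ {G} pullback λ t →
    ℕ.≤-trans (χ-hom {G} {H} h hom (bag pullback t) (bag D t) (λ _ p → p)) (χ-bag≤ {H} D t)

-- Enumerations

module _ (G : Graph) (σ : Enumeration G) where
  open Graph G using (Adj; adj?)

  position : Vertex G → Fin (order G)
  position = Inverse.from σ

  EarlyNeighbour : Fin (order G) → Vertex G → Set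
  EarlyNeighbour i x = ∃ λ u → position u Fin.≤ i × Adj x u

  earlyNeighbour? : ∀ i → U.Decidable (EarlyNeighbour i)
  earlyNeighbour? i x = anyVertex? G λ u → position u Fin.≤? i ×-dec adj? x u

  -- A vertex of `upTo i` that does not come before `i` sits at position `i` itself.
  ∈X⁻ : ∀ {i x} → x ∈ X[_] G σ i →
        i Fin.≤ position x × (x ≡ Inverse.to σ i ⊎ EarlyNeighbour i x)
  ∈X⁻ {i} {x} p with nbh , notBefore ← toWitness p = i≤x , earlier (toWitness nbh)
    where
    i≤x : i Fin.≤ position x
    i≤x = ℕ.≮⇒≥ (notBefore ∘ fromWitness)
    earlier : InClosedNeighbourhood G (upTo G σ i) x → x ≡ Inverse.to σ i ⊎ EarlyNeighbour i x
    earlier (inj₁ q) = inj₁ (trans (sym (Inverse.strictlyInverseˡ σ x))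
      (cong (Inverse.to σ) (Fin.≤-antisym (toWitness q) i≤x)))
    earlier (inj₂ (u , q , a)) = inj₂ (u , toWitness q , a)

  ∈X⁺ : ∀ {i x} → i Fin.≤ position x → EarlyNeighbour i x → x ∈ X[_] G σ i
  ∈X⁺ i≤x (u , u≤i , a) =
    fromWitness (fromWitness (inj₂ (u , fromWitness u≤i , a)) , ℕ.≤⇒≯ i≤x ∘ toWitness)

  -- The vertices of X[ i ] are among the last n − i ones.
  χ-X≤ : ∀ i → χ G (X[_] G σ i) ≤ order G ∸ toℕ i
  χ-X≤ i = colouring⇒χ≤ G (X[_] G σ i)
    (λ v p → fromℕ< (ℕ.∸-monoˡ-< (Fin.toℕ<n (position v)) (proj₁ (∈X⁻ {x = v} p))))
    λ {u} {v} p q a eq → adj-distinct a (Inverse.strictlyInverseˡ σ u) (Inverse.strictlyInverseˡ σ v)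
      (Fin.toℕ-injective (ℕ.∸-cancelʳ-≡ (proj₁ (∈X⁻ {x = u} p)) (proj₁ (∈X⁻ {x = v} q))
        (Fin.fromℕ<-injective _ _ _ _ eq)))
    where
    adj-distinct : ∀ {u v} {i j : Fin (order G)} → Adj u v →
                   Inverse.to σ i ≡ u → Inverse.to σ j ≡ v → i ≢ j
    adj-distinct a refl refl refl = Graph.adj-irrefl G a

-- Colourings of bags of R m G

module Shading (m : ℕ) (G : Graph) {c : ℕ} (B : VertexSet (R m G))
               (f : Vertex (R m G) → Fin c) (proper : ProperOn (R m G) B f) where
  open Graph G using (Adj; adj-sym)

  Repeated : Vertex G → Fin c → Set
  Repeated x a = ∃₂ λ p q → p ≢ q ×
    ((p , just x) ∈ B × f (p , just x) ≡ a) × ((q , just x) ∈ B × f (q , just x) ≡ a)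

  -- At least one of the two copies of `y` coloured `a` lies outside copy `h`, and that one is
  -- adjacent to `(h , just x)`.
  ≢repeated : ∀ {h x y a} → (h , just x) ∈ B → Repeated y a → Adj x y → f (h , just x) ≢ a
  ≢repeated {h} hx (p , q , p≢q , (py , refl) , (qy , eq)) x~y with h Fin.≟ p
  ... | no h≢p   = proper hx py (across h≢p x~y)
  ... | yes refl = proper hx qy (across p≢q x~y) ∘ (λ e → trans e (sym eq))

  repeated : ∀ {W x} → Unique W → c < length W → (∀ {p} → p ∈ₗ W → (p , just x) ∈ B) →
             ∃ (Repeated x)
  repeated {x = x} u lt W⊆B
    with p , q , p∈ , q∈ , p≢q , eq ← pigeonholeList u lt (λ p → f (p , just x)) =
    _ , p , q , p≢q , (W⊆B p∈ , eq) , (W⊆B q∈ , refl)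

  -- Outside an independent set S of vertices of G we use repeated colours,
  -- and on S the colours found in the single copy h.
  Shade : Fin m → (Vertex G → Set) → Vertex G → Fin c → Set
  Shade h S x a = Repeated x a ⊎ (S x × (h , just x) ∈ B × f (h , just x) ≡ a)

  shade-proper : ∀ {h S} → (∀ {x y} → S x → S y → ¬ Adj x y) →
                 ∀ {x y a b} → Shade h S x a → Shade h S y b → Adj x y → a ≢ b
  shade-proper _ (inj₁ (p , _ , _ , (px , refl) , _)) (inj₁ ry) x~y = ≢repeated px ry x~y
  shade-proper _ (inj₁ rx) (inj₂ (_ , hy , refl)) x~y = ≢repeated hy rx (adj-sym x~y) ∘ sym
  shade-proper _ (inj₂ (_ , hx , refl)) (inj₁ ry) x~y = ≢repeated hx ry x~y
  shade-proper indep (inj₂ (sx , _)) (inj₂ (sy , _)) x~y = contradiction x~y (indep sx sy)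

  χ-shade≤ : ∀ {h S} → (∀ {x y} → S x → S y → ¬ Adj x y) →
             ∀ X → (∀ x → x ∈ X → ∃ (Shade h S x)) → χ G X ≤ c
  χ-shade≤ indep X shade = colouring⇒χ≤ G X (λ x p → proj₁ (shade x p))
    (λ p q → shade-proper indep (proj₂ (shade _ p)) (proj₂ (shade _ q)))

-- The colour α of the hub of copy h can be avoided: where the repeated colour
-- is α, use the colour in copy h instead.
χ-hub≤ : ∀ {m G c} (B : VertexSet (R m G)) → χ (R m G) B ≤ suc c →
         ∀ {W} → Unique W → suc c < length W →
         ∀ X → (∀ {p} x → p ∈ₗ W → x ∈ X → (p , just x) ∈ B) →
         ∀ {h} → h ∈ₗ W → (h , nothing) ∈ B → χ G X ≤ c
χ-hub≤ {m} {G} {c} B le u lt X W⊆B {h} h∈W hub∈B = avoidHub (χ≤⇒colouring (R m G) B le)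
  where
  avoidHub : (∃ λ (f : Vertex (R m G) → Fin (suc c)) → ProperOn (R m G) B f) → χ G X ≤ c
  avoidHub (f , proper) =
    colouring⇒χ≤ G X (λ x p → punchOut (proj₂ (proj₂ (shade x p))))
      (λ {x} {y} p q x~y →
        shade-proper independent (proj₁ (proj₂ (shade x p))) (proj₁ (proj₂ (shade y q))) x~y ∘
        Fin.punchOut-injective (proj₂ (proj₂ (shade x p))) (proj₂ (proj₂ (shade y q))))
    where
    open Shading m G B f proper
    α = f (h , nothing)
    S : Vertex G → Set
    S x = Repeated x α
    -- Adjacent vertices cannot repeat the same colour, so those repeating `α` can serve as the
    -- independent set of a shading.
    independent : ∀ {x y} → S x → S y → ¬ Graph.Adj G x y
    independent (_ , _ , _ , (px , eq) , _) ry x~y = ≢repeated px ry x~y eq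
    shade : ∀ x → x ∈ X → ∃ λ a → Shade h S x a × α ≢ a
    shade x p with repeated u lt (λ p∈W → W⊆B x p∈W p)
    ... | a , rx with a Fin.≟ α
    ...   | no a≢α   = a , inj₁ rx , a≢α ∘ sym
    ...   | yes refl = f (h , just x) , inj₂ (rx , W⊆B x h∈W p , refl) ,
                       proper hub∈B (W⊆B x h∈W p) fromHub

-- Bounds on the path-chromatic number of R m G

module _ (m : ℕ) (G : Graph) where
  open Graph G using (Adj)

  module _ (n≤m : order G ≤ m) where

    -- Each vertex is sent to a copy of its own, so that every edge of `G` becomes an edge between
    -- different copies.
    diagonal : Vertex G → Vertex (R m G)
    diagonal v = inject≤ (Inverse.from (Graph.enum G) v) n≤m , just v

    diagonal-hom : ∀ {u v} → Adj u v → RAdj m G (diagonal u) (diagonal v)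
    diagonal-hom {u} {v} u~v = across (λ eq →
      Graph.adj-irrefl G (subst (Adj u) (sym (index-injective (Fin.inject≤-injective n≤m n≤m _ _ eq))) u~v)) u~v
      where
      index-injective : Inverse.from (Graph.enum G) u ≡ Inverse.from (Graph.enum G) v → u ≡ v
      index-injective eq = trans (sym (Inverse.strictlyInverseˡ (Graph.enum G) u))
        (trans (cong (Inverse.to (Graph.enum G)) eq) (Inverse.strictlyInverseˡ (Graph.enum G) v))

    R-lowerBound : ∀ {k} → IsPathChromaticNumber G k →
                   ∀ (D : PathDecomposition (R m G)) → k ≤ χ-decomposition D
    R-lowerBound isχP D =
      ℕ.≤-trans (pathChromaticNumber≤ isχP (pullback {G} {R m G} diagonal diagonal-hom D))
                (χ-pullback≤ {G} {R m G} diagonal diagonal-hom D)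

  module _ (v₀ : Vertex G) (D : PathDecomposition G) where

    hubBag : Fin (PathDecomposition.length D) → VertexSet (R m G)
    hubBag t (_ , nothing) = true
    hubBag t (_ , just v)  = bag D t v

    withHubs : PathDecomposition (R m G)
    withHubs = record
      { length      = PathDecomposition.length D
      ; bag         = hubBag
      ; covers      = λ where
          -- Hubs lie in every bag; `v₀` guarantees that there is a bag at all.
          (_ , nothing) → proj₁ (covers D v₀) , _
          (_ , just v)  → covers D v
      ; coversEdges = λ where
          _ _ (fromHub {v = v}) → proj₁ (covers D v) , _ , proj₂ (covers D v)
          _ _ (toHub {v = v})   → proj₁ (covers D v) , proj₂ (covers D v) , _
          _ _ (across _ a)      → coversEdges D _ _ a
      ; consecutive = λ where
          (_ , nothing) _ _ _ _ → _
          (_ , just v)          → consecutive D v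
      }
    -- Copies of one vertex are never adjacent, so all copies inherit its colour. The hubs are
    -- pairwise nonadjacent and share one new colour.
    hubColouring : ∀ {c} t → (∃ λ (f : Vertex G → Fin (suc c)) → ProperOn G (bag D t) f) →
                   χ (R m G) (bag withHubs t) ≤ suc (suc c)
    hubColouring {c} t (f , proper) = properOn⇒χ≤ (R m G) (bag withHubs t) g (λ {y} {z} → g-proper {y} {z})
      where
      g : Vertex (R m G) → Fin (suc (suc c))
      g (_ , nothing) = fromℕ (suc c)
      g (_ , just v)  = inject₁ (f v)
      g-proper : ProperOn (R m G) (bag withHubs t) g
      g-proper _ _ fromHub      = Fin.fromℕ≢inject₁
      g-proper _ _ toHub        = Fin.fromℕ≢inject₁ ∘ sym
      g-proper p q (across _ a) = proper p q a ∘ Fin.inject₁-injective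

    χ-withHubs≤ : ∀ {c} → χ-decomposition D ≤ suc c → χ-decomposition withHubs ≤ suc (suc c)
    χ-withHubs≤ {c} le = χ-decomposition≤ {R m G} withHubs {suc (suc c)}
      (λ t → hubColouring {c} t (bagColouring {G} D {c} le t))

-- Decomposing R m G along a special enumeration

module _ (G : Graph) (σ : Enumeration G) where
  open Graph G using (Adj; adj-sym; adj-irrefl)

  -- This is `X[ i ]`, except that the vertex at position `i` is left out when it has no earlier
  -- neighbour.
  frontier : Fin (order G) → VertexSet G
  frontier i x = ⌊ i Fin.≤? position G σ x ×-dec earlyNeighbour? G σ i x ⌋


  ∈frontier⁻ : ∀ {i x} → x ∈ frontier i → i Fin.≤ position G σ x × EarlyNeighbour G σ i x
  ∈frontier⁻ = toWitness

  -- The frontier lies in X[ p ] for the position p of its first vertex, and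
  -- that vertex has an earlier neighbour.
  χ-frontier≤ : ∀ {c} →
    (∀ i j → j Fin.< i → Adj (Inverse.to σ i) (Inverse.to σ j) → χ G (X[_] G σ i) ≤ c) →
    ∀ i → χ G (frontier i) ≤ c
  χ-frontier≤ {c} bound i = decide (Fin.any? inFrontier?)
    where
    InFrontier : Fin (order G) → Set
    InFrontier p = Inverse.to σ p ∈ frontier i
    inFrontier? : U.Decidable InFrontier
    inFrontier? p = T? (frontier i (Inverse.to σ p))
    at : ∀ v → v ∈ frontier i → InFrontier (position G σ v)
    at v = subst (_∈ frontier i) (sym (Inverse.strictlyInverseˡ σ v))
    nonempty : ∀ p → i Fin.≤ p → EarlyNeighbour G σ i (Inverse.to σ p) →
               (∀ q → InFrontier q → p Fin.≤ q) → χ G (frontier i) ≤ c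
    nonempty p i≤p (u , u≤i , a) lb =
      ℕ.≤-trans (χ-mono G (frontier i) (X[_] G σ p) frontier⊆X)
        (bound p (position G σ u) u<p (subst (Adj (Inverse.to σ p)) (sym (Inverse.strictlyInverseˡ σ u)) a))
      where
      u<p : position G σ u Fin.< p
      u<p = Fin.≤∧≢⇒< (ℕ.≤-trans u≤i i≤p) λ eq →
        adj-irrefl (subst (Adj (Inverse.to σ p))
          (trans (sym (Inverse.strictlyInverseˡ σ u)) (cong (Inverse.to σ) eq)) a)
      earlier : ∀ {v} → EarlyNeighbour G σ i v → EarlyNeighbour G σ p v
      earlier (w , w≤i , b) = w , ℕ.≤-trans w≤i i≤p , b
      frontier⊆X : ∀ v → v ∈ frontier i → v ∈ X[_] G σ p
      frontier⊆X v q = ∈X⁺ G σ (lb (position G σ v) (at v q)) (earlier (proj₂ (∈frontier⁻ {x = v} q)))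
    decide : Dec (∃ InFrontier) → χ G (frontier i) ≤ c
    decide (no ∄) = colouring⇒χ≤ G (frontier i)
      (λ v p → contradiction (_ , at v p) ∄) (λ {u} p → contradiction (_ , at u p) ∄)
    decide (yes ∃p) = first (leastFin inFrontier? ∃p)
      where
      first : (∃ λ p → InFrontier p × (∀ q → InFrontier q → p Fin.≤ q)) → χ G (frontier i) ≤ c
      first (p , p∈ , lb) = nonempty p
        (subst (i Fin.≤_) (Inverse.strictlyInverseʳ σ p) (proj₁ (∈frontier⁻ {x = Inverse.to σ p} p∈)))
        (proj₂ (∈frontier⁻ {x = Inverse.to σ p} p∈)) lb

  module _ (m : ℕ) where

    -- A bag index encodes a pair of a position and a copy; `combine` orders these pairs
    -- lexicographically.
    step : Fin (order G * m) → Fin (order G)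
    step t = proj₁ (remQuot {order G} m t)

    copyAt : Fin (order G * m) → Fin m
    copyAt t = proj₂ (remQuot {order G} m t)

    combine-step-copyAt : ∀ t → combine (step t) (copyAt t) ≡ t
    combine-step-copyAt = Fin.combine-remQuot {order G} m

    step-combine : ∀ (l : Fin (order G)) i → step (combine l i) ≡ l
    step-combine l i = cong proj₁ (Fin.remQuot-combine {order G} l i)

    copyAt-combine : ∀ (l : Fin (order G)) i → copyAt (combine l i) ≡ i
    copyAt-combine l i = cong proj₂ (Fin.remQuot-combine {order G} l i)

    step-mono : ∀ {s t} → s Fin.≤ t → step s Fin.≤ step t
    step-mono {s} {t} s≤t = ℕ.≮⇒≥ λ lt → ℕ.≤⇒≯ s≤t
      (subst₂ Fin._<_ (combine-step-copyAt t) (combine-step-copyAt s)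
        (Fin.combine-monoˡ-< (copyAt t) (copyAt s) lt))

    InBag : Fin (order G * m) → Fin m → Vertex G → Set
    InBag t i v = v ∈ frontier (step t) ⊎ (position G σ v ≡ step t × i ≡ copyAt t)

    inBag? : ∀ t i → U.Decidable (InBag t i)
    inBag? t i v = T? (frontier (step t) v) ⊎-dec
                   (position G σ v Fin.≟ step t ×-dec i Fin.≟ copyAt t)

    -- At step l the vertices (1 , σ l), …, (m , σ l) are treated one at a time.
    stepwiseBag : Fin (order G * m) → VertexSet (R m G)
    stepwiseBag t (i , nothing) = true
    stepwiseBag t (i , just v)  = ⌊ inBag? t i v ⌋

    own-bag : ∀ i v → InBag (combine (position G σ v) i) i v
    own-bag i v = inj₂ (sym (step-combine (position G σ v) i) , sym (copyAt-combine (position G σ v) i))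

    -- While any copy of `u` is being treated, its later neighbour `v` is in the frontier, hence
    -- present in every copy.
    neighbour-bag : ∀ {u v} i j → Adj u v → position G σ u Fin.≤ position G σ v →
                    InBag (combine (position G σ u) i) j v
    neighbour-bag {u} {v} i j a u≤v = inj₁ (fromWitness
      ( subst (Fin._≤ position G σ v) (sym eq) u≤v
      , u , Fin.≤-reflexive (sym eq) , adj-sym a))
      where
      eq = step-combine (position G σ u) i

    step≤position : ∀ {t i v} → InBag t i v → step t Fin.≤ position G σ v
    step≤position (inj₁ p)        = proj₁ (toWitness p)
    step≤position (inj₂ (eq , _)) = Fin.≤-reflexive (sym eq)

    -- Once in the frontier, a vertex stays there through the step of its own position. If it is in
    -- bag `r` because it is being treated, then `r`, `s` and `t` belong to the same step: either
    -- the frontier of that step contains it, or `r` and `t` treat the same copy and all three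
    -- coincide.
    inBag-consecutive : ∀ i v {r s t} → r Fin.≤ s → s Fin.≤ t →
                        InBag r i v → InBag t i v → InBag s i v
    inBag-consecutive i v {r} {s} {t} r≤s s≤t (inj₁ p) q with _ , u , u≤ , a ← toWitness p =
      inj₁ (fromWitness ( ℕ.≤-trans (step-mono s≤t) (step≤position {t} {i} q)
                        , u , ℕ.≤-trans u≤ (step-mono r≤s) , a))
    inBag-consecutive i v {r} {s} {t} r≤s s≤t (inj₂ (eq , i≡r)) q = last q
      where
      t≤r : step t Fin.≤ step r
      t≤r = subst (step t Fin.≤_) eq (step≤position {t} {i} q)
      step-t≡s : step t ≡ step s
      step-t≡s = Fin.≤-antisym (ℕ.≤-trans t≤r (step-mono r≤s)) (step-mono s≤t)
      step-r≡t : step r ≡ step t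
      step-r≡t = Fin.≤-antisym (step-mono (ℕ.≤-trans r≤s s≤t)) t≤r
      last : InBag t i v → InBag s i v
      last (inj₁ q)         = inj₁ (subst (λ l → v ∈ frontier l) step-t≡s q)
      last (inj₂ (_ , i≡t)) = subst (λ s → InBag s i v) r≡s (inj₂ (eq , i≡r))
        where
        r≡t : r ≡ t
        r≡t = trans (sym (combine-step-copyAt r))
          (trans (cong₂ combine step-r≡t (trans (sym i≡r) i≡t)) (combine-step-copyAt t))
        r≡s : r ≡ s
        r≡s = Fin.≤-antisym r≤s (subst (s Fin.≤_) (sym r≡t) s≤t)

    stepwise : Vertex G → PathDecomposition (R m G)
    stepwise v₀ = record
      { length      = order G * m
      ; bag         = stepwiseBag
      ; covers      = λ where
          (i , nothing) → combine (position G σ v₀) i , _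
          (i , just v)  → combine (position G σ v) i , fromWitness (own-bag i v)
      ; coversEdges = λ where
          _ _ (fromHub {i} {v}) → combine (position G σ v) i , _ , fromWitness (own-bag i v)
          _ _ (toHub {i} {v})   → combine (position G σ v) i , fromWitness (own-bag i v) , _
          _ _ (across {i} {j} {u} {v} _ a) → acrossEdge i j u v a
      ; consecutive = λ where
          (_ , nothing) _ _ _ _ → _
          (i , just v) r≤s s≤t p q →
            fromWitness (inBag-consecutive i v r≤s s≤t (toWitness p) (toWitness q))
      }
      where
      acrossEdge : ∀ i j u v → Adj u v →
        ∃ λ t → (i , just u) ∈ stepwiseBag t × (j , just v) ∈ stepwiseBag t
      -- The bag that treats the endpoint with the smaller position contains both endpoints.
      acrossEdge i j u v a with Fin.≤-total (position G σ u) (position G σ v)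
      ... | inj₁ u≤v = _ , fromWitness (own-bag i u) , fromWitness (neighbour-bag i j a u≤v)
      ... | inj₂ v≤u = _ , fromWitness (neighbour-bag j i (adj-sym a) v≤u) , fromWitness (own-bag j v)

    -- Copy i is independent, so that it can be coloured with the colour of the
    -- other hubs; this leaves 0 for its own hub.
    χ-stepwise-bag≤ : ∀ {c} v₀ t →
      (∃ λ (f : Vertex G → Fin (suc c)) → ProperOn G (frontier (step t)) f) →
      χ (R m G) (bag (stepwise v₀) t) ≤ suc (suc c)
    χ-stepwise-bag≤ {c} v₀ t (f , proper) =
      properOn⇒χ≤ (R m G) (bag (stepwise v₀) t) g (λ {y} {z} → g-proper {y} {z})
      where
      top : Fin (suc (suc c))
      top = fromℕ (suc c)
      g : Vertex (R m G) → Fin (suc (suc c))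
      g (j , nothing) with j Fin.≟ copyAt t
      ... | yes _ = zero
      ... | no _  = top
      g (j , just v) with j Fin.≟ copyAt t
      ... | yes _ = top
      ... | no _  = inject₁ (f v)
      inFrontier : ∀ {j v} → j ≢ copyAt t → InBag t j v → v ∈ frontier (step t)
      inFrontier _   (inj₁ p)       = p
      inFrontier j≢i (inj₂ (_ , e)) = contradiction e j≢i
      hub≢ : ∀ j v → g (j , nothing) ≢ g (j , just v)
      hub≢ j v with j Fin.≟ copyAt t
      ... | yes _ = λ ()
      ... | no _  = Fin.fromℕ≢inject₁
      g-proper : ProperOn (R m G) (bag (stepwise v₀) t) g
      g-proper _ _ (fromHub {i} {v}) = hub≢ i v
      g-proper _ _ (toHub {i} {v})   = hub≢ i v ∘ sym
      g-proper {i , just u} {j , just v} p q (across i≢j a) with i Fin.≟ copyAt t | j Fin.≟ copyAt t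
      ... | yes e | yes e′ = λ _ → i≢j (trans e (sym e′))
      ... | yes _ | no _   = Fin.fromℕ≢inject₁
      ... | no _  | yes _  = Fin.fromℕ≢inject₁ ∘ sym
      ... | no ¬e | no ¬e′ =
        proper (inFrontier ¬e (toWitness p)) (inFrontier ¬e′ (toWitness q)) a ∘ Fin.inject₁-injective

-- Reading off a special enumeration from a decomposition of R m G

module _ {m : ℕ} {G : Graph} (D : PathDecomposition (R m G)) where

  lastBag : ∀ y → ∃ λ t → y ∈ bag D t × (∀ s → y ∈ bag D s → s Fin.≤ t)
  lastBag y = greatestFin (λ t → T? (bag D t y)) (covers D y)

  last : Vertex (R m G) → Fin (PathDecomposition.length D)
  last y = proj₁ (lastBag y)

  in-last : ∀ y → y ∈ bag D (last y)
  in-last y = proj₁ (proj₂ (lastBag y))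

  ≤last : ∀ {y t} → y ∈ bag D t → t Fin.≤ last y
  ≤last {y} {t} = proj₂ (proj₂ (lastBag y)) t

  until-last : ∀ {y s t} → y ∈ bag D s → s Fin.≤ t → t Fin.≤ last y → y ∈ bag D t
  until-last {y} p s≤t t≤last = consecutive D y s≤t t≤last p (in-last y)

  module _ {c} (bound : ∀ t → χ (R m G) (bag D t) ≤ suc c)
           (t : Fin (PathDecomposition.length D)) (X : VertexSet G)
           {W : List (Fin m)} (unique : Unique W) (large : suc c < length W)
           (W⊆bag : ∀ {p} x → p ∈ₗ W → x ∈ X → (p , just x) ∈ bag D t) where

    -- The hub of W that leaves last, or arrives first, meets all of W × X.
    HubIn : Fin (PathDecomposition.length D) → Set
    HubIn s = Any (λ h → (h , nothing) ∈ bag D s) W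

    hubIn? : U.Decidable HubIn
    hubIn? s = any? (λ h → T? (bag D s (h , nothing))) W

    member : ∃ λ h → h ∈ₗ W
    member = element large
      where
      element : ∀ {n} {xs : List (Fin m)} → n < length xs → ∃ λ h → h ∈ₗ xs
      element {xs = x ∷ _} _ = x , here refl

    χ-hubIn≤ : ∀ s → HubIn s → (∀ {p} x → p ∈ₗ W → x ∈ X → (p , just x) ∈ bag D s) → χ G X ≤ c
    χ-hubIn≤ s hub W⊆s = χ-hub≤ {m} {G} {c} (bag D s) (bound s) unique large X W⊆s
      (proj₁ (proj₂ (find hub))) (proj₂ (proj₂ (find hub)))

    -- Let `s` be the last bag with a hub of `W`. Each hub shares with its vertices over `X` a bag
    -- no later than `s`, and these vertices are still present at `t`, so they all lie in bag `s`.
    χ≤-hubsBefore : (∀ {p} → p ∈ₗ W → last (p , nothing) Fin.< t) → χ G X ≤ c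
    χ≤-hubsBefore before = go (greatestFin hubIn? (_ , lose (proj₂ member) (in-last _)))
      where
      go : (∃ λ s → HubIn s × (∀ r → HubIn r → r Fin.≤ s)) → χ G X ≤ c
      go (s , hub , ub) = χ-hubIn≤ s hub W⊆s
        where
        s≤t : s Fin.≤ t
        s≤t with h , h∈W , h∈s ← find hub = ℕ.≤-trans (≤last h∈s) (ℕ.<⇒≤ (before h∈W))
        W⊆s : ∀ {p} x → p ∈ₗ W → x ∈ X → (p , just x) ∈ bag D s
        W⊆s x p∈W x∈X with r , hub∈r , x∈r ← coversEdges D _ _ (fromHub {v = x}) =
          consecutive D _ (ub r (lose p∈W hub∈r)) s≤t x∈r (W⊆bag x p∈W x∈X)

    -- Let `s` be the first bag from `t` on with a hub of `W`. A vertex over `X` meeting its hub at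
    -- or after `t` survives until `s`; if they meet at or before `t`, the hub is present at `t`,
    -- and then `s` equals `t`.
    χ≤-hubsAfter : (∀ {p} → p ∈ₗ W → t Fin.≤ last (p , nothing)) → χ G X ≤ c
    χ≤-hubsAfter after = go (leastFin (λ s → t Fin.≤? s ×-dec hubIn? s)
      (_ , after (proj₂ member) , lose (proj₂ member) (in-last _)))
      where
      go : (∃ λ s → (t Fin.≤ s × HubIn s) × (∀ r → t Fin.≤ r × HubIn r → s Fin.≤ r)) → χ G X ≤ c
      go (s , (t≤s , hub) , lb) = χ-hubIn≤ s hub W⊆s
        where
        W⊆s : ∀ {p} x → p ∈ₗ W → x ∈ X → (p , just x) ∈ bag D s
        W⊆s {p} x p∈W x∈X = meet (coversEdges D _ _ (fromHub {v = x}))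
          where
          x∈t : (p , just x) ∈ bag D t
          x∈t = W⊆bag x p∈W x∈X
          meet : (∃ λ r → (p , nothing) ∈ bag D r × (p , just x) ∈ bag D r) → (p , just x) ∈ bag D s
          meet (r , hub∈r , x∈r) = [ later , earlier ]′ (Fin.≤-total t r)
            where
            later : t Fin.≤ r → (p , just x) ∈ bag D s
            later t≤r = consecutive D _ t≤s (lb r (t≤r , lose p∈W hub∈r)) x∈t x∈r
            earlier : r Fin.≤ t → (p , just x) ∈ bag D s
            earlier r≤t = subst (λ s → (p , just x) ∈ bag D s) (Fin.≤-antisym t≤s s≤t) x∈t
              where
              s≤t : s Fin.≤ t
              s≤t = lb t (ℕ.≤-refl , lose p∈W (until-last hub∈r r≤t (after p∈W)))

  -- The copies are split by whether their hub is gone before `t`; one of the two classes has more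
  -- than `suc c` members.
  χ≤-copies : ∀ {c} → (∀ t → χ (R m G) (bag D t) ≤ suc c) → ∀ t X {W} → Unique W →
              suc c + suc c < length W →
              (∀ {p} x → p ∈ₗ W → x ∈ X → (p , just x) ∈ bag D t) → χ G X ≤ c
  χ≤-copies {c} bound t X {W} unique large W⊆bag = split (suc c ℕ.<? length (filter before? W))
    where
    before? : U.Decidable (λ p → last (p , nothing) Fin.< t)
    before? p = last (p , nothing) Fin.<? t
    after? = ¬? ∘ before?
    split : Dec (suc c < length (filter before? W)) → χ G X ≤ c
    split (yes lt) = χ≤-hubsBefore bound t X (filter⁺ before? unique) lt
      (λ x p∈ → W⊆bag x (proj₁ (∈-filter⁻ before? {xs = W} p∈)))
      (λ p∈ → proj₂ (∈-filter⁻ before? {xs = W} p∈))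
    split (no ¬lt) = χ≤-hubsAfter bound t X (filter⁺ after? unique)
      (ℕ.+-cancelˡ-< (suc c) _ _ (ℕ.<-≤-trans large (ℕ.≤-trans
        (ℕ.≤-reflexive (length-filter-split before? W)) (ℕ.+-monoˡ-≤ _ (ℕ.≮⇒≥ ¬lt)))))
      (λ x p∈ → W⊆bag x (proj₁ (∈-filter⁻ after? {xs = W} p∈)))
      (λ p∈ → ℕ.≮⇒≥ (proj₂ (∈-filter⁻ after? {xs = W} p∈)))

-- Ordering the vertices by the disappearance of their first copy

module _ {m : ℕ} {G : Graph} (D : PathDecomposition (R (suc m) G)) where
  open Graph G using (Adj; enum)

  -- First means first to disappear; the minimum exists because there are `suc m` copies.
  firstCopy : ∀ v → ∃ λ i → ∀ j → last D (i , just v) Fin.≤ last D (j , just v)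
  firstCopy v = argmin (λ i → toℕ (last D (i , just v)))

  copy : Vertex G → Fin (suc m)
  copy v = proj₁ (firstCopy v)

  death : Vertex G → Fin (PathDecomposition.length D)
  death v = last D (copy v , just v)

  sorted : ∃ λ (π : Permutation′ (order G)) → ∀ i j → i Fin.≤ j →
           death (Inverse.to enum (π ⟨$⟩ʳ i)) Fin.≤ death (Inverse.to enum (π ⟨$⟩ʳ j))
  sorted = sortingPermutation (toℕ ∘ death ∘ Inverse.to enum)

  byDeath : Enumeration G
  byDeath = enum ↔-∘ proj₁ sorted

  vertexAt : Fin (order G) → Vertex G
  vertexAt = Inverse.to byDeath

  death-mono : ∀ {u v} → position G byDeath u Fin.≤ position G byDeath v → death u Fin.≤ death v
  death-mono {u} {v} u≤v = subst₂ (λ u v → death u Fin.≤ death v)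
    (Inverse.strictlyInverseˡ byDeath u) (Inverse.strictlyInverseˡ byDeath v)
    (proj₂ sorted _ _ u≤v)

  time : Fin (order G) → Fin (PathDecomposition.length D)
  time i = death (vertexAt i)

  death≤time : ∀ {u i} → position G byDeath u Fin.≤ i → death u Fin.≤ time i
  death≤time {u} {i} u≤i =
    death-mono (subst (position G byDeath u Fin.≤_) (sym (Inverse.strictlyInverseʳ byDeath i)) u≤i)

  time≤death : ∀ {v i} → i Fin.≤ position G byDeath v → time i Fin.≤ death v
  time≤death {v} {i} i≤v =
    death-mono (subst (Fin._≤ position G byDeath v) (sym (Inverse.strictlyInverseʳ byDeath i)) i≤v)

  -- The copies in which one of the vertices at positions up to `i` disappears first. Repetitions
  -- are harmless, as only an upper bound on their number matters.
  spent : Fin (order G) → List (Fin (suc m))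
  spent i = tabulate {n = suc (toℕ i)} (λ j → copy (vertexAt (inject≤ j (Fin.toℕ<n i))))

  copy∈spent : ∀ {u i} → position G byDeath u Fin.≤ i → copy u ∈ₗ spent i
  copy∈spent {u} {i} u≤i = subst (λ v → copy v ∈ₗ spent i)
    (trans (cong vertexAt eq) (Inverse.strictlyInverseˡ byDeath u))
    (∈-tabulate⁺ {f = λ j → copy (vertexAt (inject≤ j (Fin.toℕ<n i)))} (fromℕ< (s≤s u≤i)))
    where
    eq : inject≤ (fromℕ< (s≤s u≤i)) (Fin.toℕ<n i) ≡ position G byDeath u
    eq = Fin.toℕ-injective (trans (Fin.toℕ-inject≤ _ (Fin.toℕ<n i)) (Fin.toℕ-fromℕ< (s≤s u≤i)))

  -- Since `p` is not `copy u`, the edge from `(p , just x)` to `(copy u , just u)` exists and lies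
  -- in a bag no later than `death u`, hence no later than `time i`. No copy of `x` disappears
  -- before `death x`, which is at or after `time i`.
  alive : ∀ {i p x} → i Fin.≤ position G byDeath x → EarlyNeighbour G byDeath i x →
          ¬ p ∈ₗ spent i → (p , just x) ∈ bag D (time i)
  alive {i} {p} {x} i≤x (u , u≤i , x~u) p∉
    with s , x∈s , u∈s ← coversEdges D (p , just x) (copy u , just u)
           (across (λ { refl → p∉ (copy∈spent {u} u≤i) }) x~u) =
    until-last D x∈s (ℕ.≤-trans (≤last D u∈s) (death≤time u≤i))
      (ℕ.≤-trans (time≤death i≤x) (proj₂ (firstCopy x) p))

  fresh : ∀ i → ∃ λ W → Unique W × suc m ≤ suc (toℕ i) + length W × (∀ {p} → p ∈ₗ W → ¬ p ∈ₗ spent i)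
  fresh i with W , unique , size , disjoint ← complement (spent i) =
    W , unique , subst (λ l → suc m ≤ l + length W) 
      (length-tabulate (λ j → copy (vertexAt (inject≤ {suc (toℕ i)} j (Fin.toℕ<n i))))) size , disjoint

  module _ {c} (bound : ∀ t → χ (R (suc m) G) (bag D t) ≤ suc c)
           (large : order G + suc c + 2 ≤ suc m) where

    -- Vertices with an early neighbour are present in more than `suc c` fresh copies and repeat a
    -- colour. The remaining vertex `vertexAt i` takes its colour in the copy that disappears at
    -- `time i`.
    χ-byDeath≤ : ∀ i → χ G (X[_] G byDeath i) ≤ suc c
    χ-byDeath≤ i = go (χ≤⇒colouring (R (suc m) G) (bag D (time i)) (bound (time i))) (fresh i)
      where
      go : (∃ λ (f : Vertex (R (suc m) G) → Fin (suc c)) → ProperOn (R (suc m) G) (bag D (time i)) f) →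
           (∃ λ W → Unique W × suc m ≤ suc (toℕ i) + length W × (∀ {p} → p ∈ₗ W → ¬ p ∈ₗ spent i)) →
           χ G (X[_] G byDeath i) ≤ suc c
      go (f , proper) (W , unique , size , disjoint) =
        Shading.χ-shade≤ (suc m) G (bag D (time i)) f proper {h = copy (vertexAt i)} {S = _≡ vertexAt i}
          (λ { refl refl → Graph.adj-irrefl G }) (X[_] G byDeath i) (λ x x∈ → shade x (∈X⁻ G byDeath {x = x} x∈))
        where
        open Shading (suc m) G (bag D (time i)) f proper
        W-large : suc c < length W
        W-large = ℕ.+-cancelˡ-< (order G) _ _ (begin-strict
          order G + suc c       <⟨ ℕ.m<m+n (order G + suc c) {2} (s≤s z≤n) ⟩
          order G + suc c + 2   ≤⟨ large ⟩
          suc m                 ≤⟨ size ⟩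
          suc (toℕ i) + length W ≤⟨ ℕ.+-monoˡ-≤ (length W) (Fin.toℕ<n i) ⟩
          order G + length W    ∎)
          where open ℕ.≤-Reasoning
        shade : ∀ x → i Fin.≤ position G byDeath x × (x ≡ vertexAt i ⊎ EarlyNeighbour G byDeath i x) →
                ∃ (Shade (copy (vertexAt i)) (_≡ vertexAt i) x)
        shade x (_ , inj₁ refl) = _ , inj₂ (refl , in-last D _ , refl)
        shade x (i≤x , inj₂ early) =
          map₂ inj₁ (repeated {x = x} unique W-large (λ p∈ → alive i≤x early (disjoint p∈)))

    -- An earlier neighbour of `vertexAt i` would make all of `X[ i ]`, including `vertexAt i`,
    -- present in every fresh copy, and `χ≤-copies` would then save a colour.
    byDeath-independent : ∀ i → suc c ≤ χ G (X[_] G byDeath i) →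
                          ∀ j → j Fin.< i → ¬ Adj (vertexAt i) (vertexAt j)
    byDeath-independent i k≤χ j j<i adj = go (fresh i)
      where
      early : ∀ {x} → x ≡ vertexAt i ⊎ EarlyNeighbour G byDeath i x → EarlyNeighbour G byDeath i x
      early (inj₁ refl) = vertexAt j ,
        subst (Fin._≤ i) (sym (Inverse.strictlyInverseʳ byDeath j)) (ℕ.<⇒≤ j<i) , adj
      early (inj₂ e) = e
      k+i≤n : suc c + toℕ i ≤ order G
      k+i≤n = begin
        suc c + toℕ i             ≤⟨ ℕ.+-monoˡ-≤ (toℕ i) (ℕ.≤-trans k≤χ (χ-X≤ G byDeath i)) ⟩
        order G ∸ toℕ i + toℕ i   ≡⟨ ℕ.m∸n+n≡m (ℕ.<⇒≤ (Fin.toℕ<n i)) ⟩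
        order G                   ∎
        where open ℕ.≤-Reasoning
      go : (∃ λ W → Unique W × suc m ≤ suc (toℕ i) + length W × (∀ {p} → p ∈ₗ W → ¬ p ∈ₗ spent i)) → ⊥
      go (W , unique , size , disjoint) = ℕ.<-irrefl refl (ℕ.≤-trans k≤χ
        (χ≤-copies {suc m} {G} D {c} bound (time i) (X[_] G byDeath i) unique W-large W⊆bag))
        where
        W⊆bag : ∀ {p} x → p ∈ₗ W → x ∈ X[_] G byDeath i → (p , just x) ∈ bag D (time i)
        W⊆bag x p∈W x∈X = alive (proj₁ (∈X⁻ G byDeath {x = x} x∈X))
          (early (proj₂ (∈X⁻ G byDeath {x = x} x∈X))) (disjoint p∈W)
        -- With k = `suc c`, n = `order G` and the zero-based `toℕ i` at most n - k, at least (n + k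
        -- + 2) - (n - k + 1) = 2k + 1 copies are fresh.
        W-large : suc c + suc c < length W
        W-large = ℕ.+-cancelˡ-≤ (suc (toℕ i)) _ _ (begin
          suc (toℕ i) + suc (suc c + suc c)    ≡⟨ rearrange (toℕ i) (suc c) ⟩
          suc c + toℕ i + suc c + 2            ≤⟨ ℕ.+-monoˡ-≤ 2 (ℕ.+-monoˡ-≤ (suc c) k+i≤n) ⟩
          order G + suc c + 2                  ≤⟨ large ⟩
          suc m                                ≤⟨ size ⟩
          suc (toℕ i) + length W               ∎)
          where
          open ℕ.≤-Reasoning
          rearrange : ∀ a b → suc a + suc (b + b) ≡ b + a + b + 2
          rearrange = solve-∀

    byDeath-special : IsPathChromaticNumber G (suc c) → IsSpecial G byDeath
    byDeath-special isχP =
      -- A decomposition of chromatic number at most the minimum `suc c` is itself optimal.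
      ((P[_] G byDeath , refl) , λ d p → ℕ.≤-trans χ≤ (proj₂ isχP d p)) ,
      λ i isχP′ → byDeath-independent i
        (ℕ.≤-reflexive (pathChromaticNumber-unique G (suc c) (χ G (X[_] G byDeath i)) isχP isχP′))
      where
      χ≤ : χ-decomposition (P[_] G byDeath) ≤ suc c
      χ≤ = χ-decomposition≤ {G} (P[_] G byDeath) {suc c} (λ i → ℕ.≤-trans
        (χ-mono G (bag (P[_] G byDeath) i) (X[_] G byDeath i) (λ _ p → p)) (χ-byDeath≤ i))

-- Upper and lower bounds combined in the two cases

theorem1p2 : (n k : ℕ) → 1 ≤ n → 2 ≤ k →
    (m : ℕ) → n + k + 2 ≤ m →
    (G : Graph) → IsPathChromaticNumber G k → order G ≡ n →
    (∃ (IsSpecial G) → IsPathChromaticNumber (R m G) k) ×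
    (¬ ∃ (IsSpecial G) → IsPathChromaticNumber (R m G) (k + 1))
theorem1p2 n k _ _ zero large = contradiction (ℕ.m+n≤o⇒n≤o (n + k) large) λ ()
theorem1p2 n (suc (suc c)) 1≤n (s≤s (s≤s z≤n)) (suc m) large G isχP refl = special , nonspecial
  where
  -- In the special case the frontiers receive k - 1 = `suc c` colours, a nonempty palette because k
  -- is at least 2.
  k = suc (suc c)

  v₀ : Vertex G
  v₀ = Inverse.to (Graph.enum G) (fromℕ< 1≤n)

  lowerBound : ∀ D → k ≤ χ-decomposition D
  lowerBound = R-lowerBound (suc m) G
    (ℕ.m+n≤o⇒m≤o (order G) (ℕ.m+n≤o⇒m≤o (order G + k) large)) isχP

  special : ∃ (IsSpecial G) → IsPathChromaticNumber (R (suc m) G) k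
  special (σ , isχP′ , independent) =
    isPathChromaticNumber {R (suc m) G} (stepwise G σ (suc m) v₀) {k}
      (χ-decomposition≤ {R (suc m) G} (stepwise G σ (suc m) v₀) {k} λ t →
        χ-stepwise-bag≤ G σ (suc m) {c} v₀ t (χ≤⇒colouring G {c} (frontier G σ (step G σ (suc m) t))
          (χ-frontier≤ G σ {suc c} bound (step G σ (suc m) t))))
      lowerBound
    where
    decomposition≡k : χ-decomposition (P[_] G σ) ≡ k
    decomposition≡k = pathChromaticNumber-unique G (χ-decomposition (P[_] G σ)) k isχP′ isχP
    χ≤k : ∀ i → χ G (X[_] G σ i) ≤ k
    χ≤k i = ℕ.≤-trans (χ-mono G (X[_] G σ i) (bag (P[_] G σ) i) (λ _ p → p))
      (ℕ.≤-trans (χ-bag≤ {G} (P[_] G σ) i) (ℕ.≤-reflexive decomposition≡k))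
    bound : ∀ i j → j Fin.< i → Graph.Adj G (Inverse.to σ i) (Inverse.to σ j) →
            χ G (X[_] G σ i) ≤ suc c
    -- If `X[ i ]` had chromatic number k, condition (ii) of a special enumeration would exclude the
    -- earlier neighbour.
    bound i j j<i adj = ℕ.≤-pred (ℕ.≤∧≢⇒< (χ≤k i) λ eq →
      independent i (subst (IsPathChromaticNumber G) (sym eq) isχP) j j<i adj)

  nonspecial : ¬ ∃ (IsSpecial G) → IsPathChromaticNumber (R (suc m) G) (k + 1)
  nonspecial ∄ = subst (IsPathChromaticNumber (R (suc m) G)) (ℕ.+-comm 1 k) (extend (proj₁ isχP))
    where
    special′ : (E : PathDecomposition (R (suc m) G)) → χ-decomposition E ≤ k → ∃ (IsSpecial G)
    special′ E le = byDeath {m} {G} E , byDeath-special {m} {G} E {suc c}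
      (λ t → ℕ.≤-trans (χ-bag≤ {R (suc m) G} E t) le) large isχP
    extend : (∃ λ (D : PathDecomposition G) → χ-decomposition D ≡ k) →
             IsPathChromaticNumber (R (suc m) G) (suc k)
    extend (D , eq) = isPathChromaticNumber {R (suc m) G} (withHubs (suc m) G v₀ D) {suc k}
      (χ-withHubs≤ (suc m) G v₀ D {suc c} (ℕ.≤-reflexive eq))
      -- A decomposition of chromatic number at most k would yield a special enumeration, so each
      -- one needs at least k + 1 colours.
      (λ E → ℕ.≰⇒> (∄ ∘ special′ E))
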